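{- Let $k\ge 0$ be an integer and let $\alpha(k,p)$ denote the lexicographically minimal critical string of a $k$-mismatch search scheme with $p$ parts (definitions in the context). Then: (a) if $k$ is odd, $\alpha(k,k+1)$ is the string $0\,1\,3\,3\,5\,5\cdots k\,k$ of length $k+1$ (i.e. $0,1$ followed by the pairs $(3,3),(5,5),\dots,(k,k)$); (b) if $k$ is even, $\alpha(k,k+1)$ is the string $0\,2\,2\,4\,4\cdots k\,k$ of length $k+1$ (i.e. $0$ followed by the pairs $(2,2),(4,4),\dots,(k,k)$).
   Context: Fix integers $k\ge 0$ and $p\ge 1$. A search (with $p$ parts and at most $k$ errors) is a triple $S=(\pi,L,U)$ where $\pi=\pi(1)\cdots\pi(p)$ is a permutation of $\{1,\dots,p\}$ written as a string and satisfying the connectivity property: for every $i>1$, $\pi(i)$ equals either $\min_{j<i}\pi(j)-1$ or $\max_{j<i}\pi(j)+1$; and $L,U$ are strings of length $p$ over $\{0,\dots,k\}$. For a string $A$ of length $p$ over the nonnegative integers, its weight is $\sum_i A[i]$. The search $S$ covers $A$ if $L[i+1]\le \sum_{j=1}^{i} A[\pi(j)]\le U[i]$ for all $i=1,\dots,p$, with the convention $L[p+1]=0$. A $k$-mismatch search scheme with $p$ parts is a finite set $\mathcal S$ of such searches such that every string $A$ of length $p$ over the nonnegative integers of weight exactly $k$ is covered by some search in $\mathcal S$. The critical string of $\mathcal S$ is the lexicographically maximal $U$-string among the searches of $\mathcal S$. $\alpha(k,p)$ is the lexicographically minimal critical string over all $k$-mismatch search schemes with $p$ parts. -}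

module Defs where

open import Data.Nat using (ℕ; zero; suc; _+_; _*_; _≤_; _<_; _⊓_; _⊔_)
open import Data.Fin using (Fin; toℕ)
open import Data.Fin.Permutation using (Permutation′; _⟨$⟩ʳ_)
open import Data.List as List using (List; []; _∷_; upTo; concatMap; allFin)
open import Data.List.Relation.Unary.Any using (Any)
open import Data.List.Relation.Unary.All as ListAll using ()
open import Data.Vec as Vec using (Vec; lookup; toList)
open import Data.Vec.Relation.Unary.All as VecAll using ()
open import Data.Vec.Relation.Binary.Lex.Strict using (Lex-≤)
open import Data.Product using (Σ; _×_)
open import Data.Sum using (_⊎_)
open import Data.Nat.ListAction using (sum)
open import Relation.Binary.PropositionalEquality using (_≡_)

_≤lex_ : ∀ {p} → Vec ℕ p → Vec ℕ p → Set
_≤lex_ = Lex-≤ _≡_ _<_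

-- i-th entry of a list, defaulting to 0 past the end
-- (used for the convention L[p+1] = 0).
at : List ℕ → ℕ → ℕ
at []       _       = 0
at (x ∷ xs) zero    = x
at (x ∷ xs) (suc n) = at xs n

minL maxL : List ℕ → ℕ
minL []       = 0
minL (x ∷ xs) = List.foldr _⊓_ x xs
maxL []       = 0
maxL (x ∷ xs) = List.foldr _⊔_ x xs

record Search (p : ℕ) : Set where
  constructor search
  field
    π : Permutation′ p
    L : Vec ℕ p
    U : Vec ℕ p
open Search public

πPrefix : ∀ {p} → Permutation′ p → ℕ → List ℕ
πPrefix {p} π i = List.map (λ j → toℕ (π ⟨$⟩ʳ j)) (List.take i (allFin p))

Connected : ∀ {p} → Permutation′ p → Set
Connected {p} π = (i : Fin p) → 1 ≤ toℕ i →
  (toℕ (π ⟨$⟩ʳ i) + 1 ≡ minL (πPrefix π (toℕ i)))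
  ⊎ (toℕ (π ⟨$⟩ʳ i) ≡ maxL (πPrefix π (toℕ i)) + 1)

ValidSearch : (k p : ℕ) → Search p → Set
ValidSearch k p S =
  Connected (π S) × VecAll.All (_≤ k) (L S) × VecAll.All (_≤ k) (U S)

weight : ∀ {p} → Vec ℕ p → ℕ
weight = Vec.sum

-- Σ_{j=1}^{i+1} A[π(j)] in 1-based terms, for 0-based i
prefixSum : ∀ {p} → Permutation′ p → Vec ℕ p → Fin p → ℕ
prefixSum {p} π A i =
  sum (List.take (suc (toℕ i)) (List.map (λ j → lookup A (π ⟨$⟩ʳ j)) (allFin p)))

-- S covers A: L[i+1] ≤ prefix_i ≤ U[i] for all i (1-based), with L[p+1] = 0
Covers : ∀ {p} → Search p → Vec ℕ p → Set
Covers {p} S A = (i : Fin p) →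
  (at (toList (L S)) (suc (toℕ i)) ≤ prefixSum (π S) A i)
  × (prefixSum (π S) A i ≤ lookup (U S) i)

IsScheme : (k p : ℕ) → List (Search p) → Set
IsScheme k p 𝒮 =
  ListAll.All (ValidSearch k p) 𝒮
  × ((A : Vec ℕ p) → weight A ≡ k → Any (λ S → Covers S A) 𝒮)

IsCritical : ∀ {p} → List (Search p) → Vec ℕ p → Set
IsCritical 𝒮 c = Any (λ S → U S ≡ c) 𝒮 × ListAll.All (λ S → U S ≤lex c) 𝒮

IsAlpha : (k p : ℕ) → Vec ℕ p → Set
IsAlpha k p α =
  Σ (List (Search p)) (λ 𝒮 → IsScheme k p 𝒮 × IsCritical 𝒮 α)
  × ((𝒮 : List (Search p)) (c : Vec ℕ p) → IsScheme k p 𝒮 → IsCritical 𝒮 c → α ≤lex c)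

oddString : ℕ → List ℕ
oddString m = 0 ∷ 1 ∷ concatMap (λ j → (2 * j + 3) ∷ (2 * j + 3) ∷ []) (upTo m)

evenString : ℕ → List ℕ
evenString m = 0 ∷ concatMap (λ j → (2 * j + 2) ∷ (2 * j + 2) ∷ []) (upTo m)

{-# OPTIONS --safe #-}

-- Taking L = 0 and U equal to the prefix sums of the covered string, one sees
-- that α(k,p) is the maximum over the strings A of weight k of the minimum over
-- the connected π of the prefix sums of A along π.
--
-- Lower bound: for A = 0 2 0 2 … 0 every window of length l has sum at least
-- 2⌊l/2⌋; for A = 0 1 2 0 2 0 … 2 0 only the order running from left to right
-- starts with the prefix sums 0, 1.
--
-- Upper bound: call 0, 01 and 10 blocks.  Either a few entries around some zero
-- give prefix sums 0 0 … or 0 1 x … with x ≤ 2, or all blocks are separated by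
-- entries ≥ 2.  Since A has one entry more than its weight, a count then forces
-- A = Z 2 Z 2 … 2 Z with blocks Z.  Start at the 0 of a pair 01 or 10 (for k even,
-- if there is no pair, at the left end) and run in one direction, picking up 2, 0,
-- 2, 0, … until the end of A is reached or the next pair is met.  The latter is
-- harmless when the 0 of that pair comes first.  Neither of two neighbouring pairs is
-- a good start towards the other only if they are 01 and 10 in this order, which
-- cannot happen twice in a row; and for k odd the number of pairs is odd.

module Submission where

open import Defs
open import Data.Nat using (ℕ; zero; suc; _+_; _*_; _≤_; _<_; z≤n; s≤s; _⊓_; _⊔_)
open import Data.Vec as Vec using (Vec; []; _∷_; toList; lookup; replicate)
open import Data.Product using (Σ; ∃; _×_; _,_; proj₁; proj₂)
open import Relation.Binary.PropositionalEquality hiding ([_])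

import Algebra.Properties.CommutativeMonoid.Sum
open import Data.Fin using (Fin; zero; suc; toℕ; fromℕ; inject₁; punchIn)
open import Data.Fin.Induction using (<-weakInduction)
open import Data.Fin.Permutation as Perm using (Permutation′; _⟨$⟩ʳ_; insert; insert-punchIn)
open import Data.Fin.Properties using (toℕ-inject₁; toℕ-fromℕ; toℕ<n) renaming (_≟_ to _≟F_)
open import Data.Fin.Relation.Unary.Top using (view; ‵fromℕ; ‵inject₁)
open import Data.List using
  (List; []; _∷_; [_]; _++_; _∷ʳ_; _ʳ++_; length; take; tabulate; map; allFin;
   concatMap; applyUpTo; upTo; cartesianProductWith)
open import Data.List.Membership.Propositional using (_∈_)
open import Data.List.Membership.Propositional.Properties using (∈-cartesianProductWith⁺; ∈-upTo⁺)
open import Data.List.Properties using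
  (take-map; take-suc-tabulate; map-tabulate; map-++; tabulate-cong; ++-assoc; ++-identityʳ;
   ∷-injective; length-map; length-++; length-tabulate)
import Data.List.Relation.Binary.Lex.Strict as List
open import Data.List.Relation.Ternary.Interleaving.Propositional using (Interleaving; []; consˡ; consʳ; swap)
open import Data.List.Relation.Ternary.Interleaving.Setoid.Properties using (++-linear)
import Data.List.Relation.Unary.All as ListAll
import Data.List.Relation.Unary.All.Properties as ListAll
open import Data.List.Relation.Unary.Any as Any using (here)
import Data.List.Relation.Unary.Any.Properties as Any
open import Data.Nat.Divisibility using (_∣_; _∣0; ∣m∣n⇒∣m+n; ∣m+n∣m⇒∣n; m∣m*n; ∣-refl; ∣1⇒≡1)
open import Data.Nat.ListAction using (sum)
open import Data.Nat.ListAction.Properties using (sum-++)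
open import Data.Nat.Properties
open import Data.Sum as Sum using (_⊎_; inj₁; inj₂)
open import Data.Unit using (tt)
import Data.Vec.Properties as Vec
open import Data.Vec.Relation.Binary.Lex.Core using (base; this; next)
import Data.Vec.Relation.Binary.Lex.Strict as Vec
open import Data.Vec.Relation.Binary.Pointwise.Inductive using (Pointwise-≡⇒≡)
open import Data.Vec.Relation.Unary.All as VecAll using ([]; _∷_)
open import Function using (_∘_)
open import Relation.Binary using (IsEquivalence)
open import Relation.Nullary using (contradiction; yes; no)
open Algebra.Properties.CommutativeMonoid.Sum +-0-commutativeMonoid using (sum-permute) renaming (sum to ∑)

private variable
  k p n : ℕ
  B : Set

-- Connected permutations

order : Permutation′ p → List ℕ
order π = tabulate (λ j → toℕ (π ⟨$⟩ʳ j))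

visits : Permutation′ p → Vec ℕ p → List ℕ
visits π A = tabulate (λ j → lookup A (π ⟨$⟩ʳ j))

πPrefix≡take : ∀ (π : Permutation′ p) i → πPrefix π i ≡ take i (order π)
πPrefix≡take {p} π i =
  trans (sym (take-map i (allFin p))) (cong (take i) (map-tabulate (λ j → j) (λ j → toℕ (π ⟨$⟩ʳ j))))

prefixSum≡ : ∀ (π : Permutation′ p) A i → prefixSum π A i ≡ sum (take (suc (toℕ i)) (visits π A))
prefixSum≡ π A i = cong (sum ∘ take (suc (toℕ i))) (map-tabulate (λ j → j) (λ j → lookup A (π ⟨$⟩ʳ j)))

tabulate-∷ʳ : (f : Fin (suc n) → B) → tabulate f ≡ tabulate (f ∘ inject₁) ∷ʳ f (fromℕ n)
tabulate-∷ʳ {zero}  f = refl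
tabulate-∷ʳ {suc n} f = cong (f zero ∷_) (tabulate-∷ʳ (f ∘ suc))

take-∷ʳ : ∀ i (xs : List B) x → i ≤ length xs → take i (xs ∷ʳ x) ≡ take i xs
take-∷ʳ zero    xs       x i≤       = refl
take-∷ʳ (suc i) (y ∷ xs) x (s≤s i≤) = cong (y ∷_) (take-∷ʳ i xs x i≤)

-- `minL` folds with its head as seed, so the recursion removes the second entry. Its default 0 on
-- `[]` would falsify the claim, whence the length hypothesis.
minL-map-suc : ∀ xs → 0 < length xs → minL (map suc xs) ≡ suc (minL xs)
minL-map-suc (x ∷ [])     _ = refl
minL-map-suc (x ∷ y ∷ xs) _ = cong (suc y ⊓_) (minL-map-suc (x ∷ xs) (s≤s z≤n))

maxL-map-suc : ∀ xs → 0 < length xs → maxL (map suc xs) ≡ suc (maxL xs)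
maxL-map-suc (x ∷ [])     _ = refl
maxL-map-suc (x ∷ y ∷ xs) _ = cong (suc y ⊔_) (maxL-map-suc (x ∷ xs) (s≤s z≤n))

minL-∷ʳ : ∀ xs y → 0 < length xs → minL (xs ∷ʳ y) ≡ minL xs ⊓ y
minL-∷ʳ (x ∷ [])     y _ = ⊓-comm y x
minL-∷ʳ (x ∷ z ∷ xs) y _ =
  trans (cong (z ⊓_) (minL-∷ʳ (x ∷ xs) y (s≤s z≤n))) (sym (⊓-assoc z (minL (x ∷ xs)) y))

maxL-∷ʳ : ∀ xs y → 0 < length xs → maxL (xs ∷ʳ y) ≡ maxL xs ⊔ y
maxL-∷ʳ (x ∷ [])     y _ = ⊔-comm y x
maxL-∷ʳ (x ∷ z ∷ xs) y _ =
  trans (cong (z ⊔_) (maxL-∷ʳ (x ∷ xs) y (s≤s z≤n))) (sym (⊔-assoc z (maxL (x ∷ xs)) y))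

-- Extending a connected order by one position visited last.

punchIn-fromℕ : (j : Fin n) → punchIn (fromℕ n) j ≡ inject₁ j
punchIn-fromℕ zero    = refl
punchIn-fromℕ (suc j) = cong suc (punchIn-fromℕ j)

insert-fromℕ : ∀ (e : Fin (suc n)) (π : Permutation′ n) → insert (fromℕ n) e π ⟨$⟩ʳ fromℕ n ≡ e
insert-fromℕ {n} e π with fromℕ n ≟F fromℕ n
... | yes _  = refl
... | no neq = contradiction refl neq

insert-inject₁ : ∀ (e : Fin (suc n)) (π : Permutation′ n) j →
  insert (fromℕ n) e π ⟨$⟩ʳ inject₁ j ≡ punchIn e (π ⟨$⟩ʳ j)
insert-inject₁ {n} e π j =
  trans (cong (insert (fromℕ n) e π ⟨$⟩ʳ_) (sym (punchIn-fromℕ j))) (insert-punchIn (fromℕ n) e π j)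

-- The extended permutation visits as `π` does, with positions relabelled to make room for `e`, and
-- comes to `e` at the very end.
tabulate-insert : ∀ (e : Fin (suc n)) (π : Permutation′ n) (f : Fin (suc n) → B) →
  tabulate (f ∘ (insert (fromℕ n) e π ⟨$⟩ʳ_)) ≡ tabulate (f ∘ punchIn e ∘ (π ⟨$⟩ʳ_)) ∷ʳ f e
tabulate-insert {n} e π f = trans (tabulate-∷ʳ (f ∘ (insert (fromℕ n) e π ⟨$⟩ʳ_)))
  (cong₂ _∷ʳ_ (tabulate-cong (cong f ∘ insert-inject₁ e π)) (cong f (insert-fromℕ e π)))

order-up : (π : Permutation′ n) → order (insert (fromℕ n) (fromℕ n) π) ≡ order π ∷ʳ n
order-up {n} π = trans (tabulate-insert (fromℕ n) π toℕ)
  (cong₂ _∷ʳ_ (tabulate-cong (λ j → trans (cong toℕ (punchIn-fromℕ _)) (toℕ-inject₁ _))) (toℕ-fromℕ n))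

order-down : (π : Permutation′ n) → order (insert (fromℕ n) zero π) ≡ map suc (order π) ∷ʳ 0
order-down π = trans (tabulate-insert zero π toℕ)
  (cong (_∷ʳ 0) (sym (map-tabulate _ suc)))

module _ {π : Permutation′ n} {xs x} (eq : order π ≡ xs ∷ʳ x) where
  πPrefix-∷ʳ : ∀ {i} → i ≤ length xs → πPrefix π i ≡ take i xs
  πPrefix-∷ʳ {i} i≤ = trans (πPrefix≡take π i) (trans (cong (take i) eq) (take-∷ʳ i xs x i≤))

take-length : ∀ (xs : List B) → take (length xs) xs ≡ xs
take-length []       = refl
take-length (x ∷ xs) = cong (x ∷_) (take-length xs)

Step : ℕ → List ℕ → Set
Step x xs = (x + 1 ≡ minL xs) ⊎ (x ≡ maxL xs + 1)

Step-suc : ∀ {x} xs → 0 < length xs → Step x xs → Step (suc x) (map suc xs)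
Step-suc xs 0< (inj₁ e) = inj₁ (trans (cong suc e) (sym (minL-map-suc xs 0<)))
Step-suc xs 0< (inj₂ e) = inj₂ (trans (cong suc e) (cong (_+ 1) (sym (maxL-map-suc xs 0<))))

length-order : (π : Permutation′ n) → length (order π) ≡ n
length-order π = length-tabulate (toℕ ∘ (π ⟨$⟩ʳ_))

-- Stated with `xs` in place of `order π` so that growth at the right end (labels kept) and at the
-- left end (labels shifted by `suc`) share one proof.
insert-connected : ∀ (π : Permutation′ n) e {xs} → length xs ≡ n →
  order (insert (fromℕ n) e π) ≡ xs ∷ʳ toℕ e →
  (∀ j → 1 ≤ toℕ j → Step (toℕ (punchIn e (π ⟨$⟩ʳ j))) (take (toℕ j) xs)) →
  Step (toℕ e) xs →
  Connected (insert (fromℕ n) e π)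
insert-connected {n} π e {xs} len eq steps last i 1≤i with view i
... | ‵fromℕ = subst₂ (λ x ys → Step (toℕ x) ys) (sym (insert-fromℕ e π))
  (sym (trans (πPrefix-∷ʳ {π = insert (fromℕ n) e π} eq (≤-reflexive len′))
    (trans (cong (λ m → take m xs) len′) (take-length xs)))) last
  where
  len′ : toℕ (fromℕ n) ≡ length xs
  len′ = trans (toℕ-fromℕ n) (sym len)
... | ‵inject₁ j = subst₂ (λ x ys → Step (toℕ x) ys) (sym (insert-inject₁ e π j))
  (sym (trans (πPrefix-∷ʳ {π = insert (fromℕ n) e π} eq
      (≤-trans (≤-reflexive (toℕ-inject₁ j)) (≤-trans (<⇒≤ (toℕ<n j)) (≤-reflexive (sym len)))))
    (cong (λ m → take m xs) (toℕ-inject₁ j))))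
  (steps j (subst (1 ≤_) (toℕ-inject₁ j) 1≤i))

-- The length is hidden because strings are lists here. `min≡` and `max≡` hold for every
-- permutation; carried along as invariants, they come for free and give the connectivity of the
-- next visit at either end.
record Realised (w us : List ℕ) : Set where
  field
    {pred} : ℕ
    entries   : Vec ℕ (suc pred)
    path      : Permutation′ (suc pred)
    entries≡  : toList entries ≡ w
    visits≡   : visits path entries ≡ us
    connected : Connected path
    min≡      : minL (order path) ≡ 0
    max≡      : maxL (order path) ≡ pred

realise-[_] : ∀ x → Realised [ x ] [ x ]
realise-[ x ] = record
  { entries = x ∷ [] ; path = Perm.id ; entries≡ = refl ; visits≡ = refl
  ; connected = λ { zero () } ; min≡ = refl ; max≡ = refl }

lookup-∷ʳ-inject₁ : ∀ (A : Vec B n) x j → lookup (A Vec.∷ʳ x) (inject₁ j) ≡ lookup A j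
lookup-∷ʳ-inject₁ (y ∷ A) x zero    = refl
lookup-∷ʳ-inject₁ (y ∷ A) x (suc j) = lookup-∷ʳ-inject₁ A x j

lookup-∷ʳ-fromℕ : ∀ (A : Vec B n) x → lookup (A Vec.∷ʳ x) (fromℕ n) ≡ x
lookup-∷ʳ-fromℕ []      x = refl
lookup-∷ʳ-fromℕ (y ∷ A) x = lookup-∷ʳ-fromℕ A x

realise-∷ : ∀ {w us} x → Realised w us → Realised (x ∷ w) (us ∷ʳ x)
realise-∷ {w} {us} x R = record
  { entries = x ∷ entries ; path = π′
  ; entries≡ = cong (x ∷_) entries≡
  ; visits≡ = trans (tabulate-insert zero path (lookup (x ∷ entries))) (cong (_∷ʳ x) visits≡)
  ; connected = insert-connected path zero
      (trans (length-map suc (order path)) (length-order path)) (order-down path) steps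
      (inj₁ (sym (trans (minL-map-suc (order path) (s≤s z≤n)) (cong suc min≡))))
  ; min≡ = trans (cong minL (order-down path))
      (trans (minL-∷ʳ (map suc (order path)) 0 (s≤s z≤n)) (⊓-zeroʳ (minL (map suc (order path)))))
  ; max≡ = trans (cong maxL (order-down path)) (trans (maxL-∷ʳ (map suc (order path)) 0 (s≤s z≤n))
      (trans (⊔-identityʳ (maxL (map suc (order path))))
        (trans (maxL-map-suc (order path) (s≤s z≤n)) (cong suc max≡)))) }
  where
  open Realised R
  π′ : Permutation′ (suc (suc pred))
  π′ = insert (fromℕ _) zero path
  steps : ∀ j → 1 ≤ toℕ j → Step (suc (toℕ (path ⟨$⟩ʳ j))) (take (toℕ j) (map suc (order path)))
  steps (suc j) 1≤j = subst (Step _) (sym (take-map (suc (toℕ j)) (order path)))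
    (Step-suc (take (suc (toℕ j)) (order path)) (s≤s z≤n)
      (subst (Step _) (πPrefix≡take path (suc (toℕ j))) (connected (suc j) 1≤j)))

realise-∷ʳ : ∀ {w us} x → Realised w us → Realised (w ∷ʳ x) (us ∷ʳ x)
realise-∷ʳ {w} {us} x R = record
  { entries = entries Vec.∷ʳ x ; path = π′
  ; entries≡ = trans (Vec.toList-∷ʳ x entries) (cong (_∷ʳ x) entries≡)
  ; visits≡ = trans (tabulate-insert top path (lookup (entries Vec.∷ʳ x)))
      (cong₂ _∷ʳ_ (trans (tabulate-cong λ j → trans
            (cong (lookup (entries Vec.∷ʳ x)) (punchIn-fromℕ (path ⟨$⟩ʳ j)))
            (lookup-∷ʳ-inject₁ entries x (path ⟨$⟩ʳ j))) visits≡)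
        (lookup-∷ʳ-fromℕ entries x))
  ; connected = insert-connected path top (length-order path)
      (trans (order-up path) (cong (order path ∷ʳ_) (sym (toℕ-fromℕ _)))) steps
      (inj₂ (trans (toℕ-fromℕ _) (trans (sym (+-comm pred 1)) (cong (_+ 1) (sym max≡)))))
  ; min≡ = trans (cong minL (order-up path))
      (trans (minL-∷ʳ (order path) (suc pred) (s≤s z≤n)) (cong (_⊓ suc pred) min≡))
  ; max≡ = trans (cong maxL (order-up path)) (trans (maxL-∷ʳ (order path) (suc pred) (s≤s z≤n))
      (trans (cong (_⊔ suc pred) max≡) (m≤n⇒m⊔n≡n (n≤1+n pred)))) }
  where
  open Realised R
  top : Fin (suc (suc pred))
  top = fromℕ (suc pred)
  π′ : Permutation′ (suc (suc pred))
  π′ = insert (fromℕ (suc pred)) top path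
  steps : ∀ j → 1 ≤ toℕ j → Step (toℕ (punchIn top (path ⟨$⟩ʳ j))) (take (toℕ j) (order path))
  steps j 1≤j = subst₂ Step
    (sym (trans (cong toℕ (punchIn-fromℕ (path ⟨$⟩ʳ j))) (toℕ-inject₁ (path ⟨$⟩ʳ j))))
    (πPrefix≡take path (toℕ j)) (connected j 1≤j)

-- The window `w` has been visited; `l`, read leftwards, and `r` remain. The interleaving tells at
-- each step which end of the window grows, and either choice keeps the order connected.
realise : ∀ {l r vs w us} → Interleaving l r vs → Realised w us → Realised (l ʳ++ (w ++ r)) (us ++ vs)
realise {w = w} {us} [] R = subst₂ Realised (sym (++-identityʳ w)) (sym (++-identityʳ us)) R
realise {l = x ∷ l} {us = us} (consˡ v) R =
  subst (Realised _) (++-assoc us [ x ] _) (realise v (realise-∷ x R))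
realise {l = l} {r = x ∷ r} {w = w} {us} (consʳ v) R =
  subst₂ Realised (cong (l ʳ++_) (++-assoc w [ x ] r)) (++-assoc us [ x ] _) (realise v (realise-∷ʳ x R))

-- The two lengths are not definitionally equal, so the equality is one of pairs; matching it with
-- `refl` identifies lengths and vectors together.
toList-Σ-injective : ∀ {m n} (A : Vec B m) (A′ : Vec B n) → toList A ≡ toList A′ →
  _≡_ {A = Σ ℕ (Vec B)} (m , A) (n , A′)
toList-Σ-injective []      []       eq = refl
toList-Σ-injective (x ∷ A) (y ∷ A′) eq with ∷-injective eq
... | refl , eq′ with toList-Σ-injective A A′ eq′
...   | refl = refl

unrealise : ∀ {us} (A : Vec ℕ p) → Realised (toList A) us →
  ∃ λ (π : Permutation′ p) → Connected π × visits π A ≡ us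
unrealise A record { entries = E ; path = π ; entries≡ = e ; visits≡ = v ; connected = c }
  with toList-Σ-injective E A e
... | refl = π , c , v

-- Good paths through a string of length one more than its weight

-- α rises by 2, 0, 2, 0, … after its start.  A path level with α just before a
-- rise by 2 ends lexicographically below α, resp. at most at α, if its further
-- increments are Low, resp. Below.
data Low : List ℕ → Set where
  low : ∀ {x vs} → x < 2 → Low (x ∷ vs)
  tie : ∀ {vs} → Low vs → Low (2 ∷ 0 ∷ vs)

-- A tie with α up to the end of the list: what follows must itself be `Below`, whereas after `Low`
-- anything may follow.
data Plain : List ℕ → Set where
  []  : Plain []
  tie : ∀ {vs} → Plain vs → Plain (2 ∷ 0 ∷ vs)

data Below : List ℕ → Set where
  []  : Below []
  low : ∀ {x vs} → x < 2 → Below (x ∷ vs)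
  tie : ∀ {vs} → Below vs → Below (2 ∷ 0 ∷ vs)

-- For odd `k`, α starts with 0 1. After the starting zero an increment 0 wins at once, and an
-- increment 1 leads to the comparison with 2, 0, 2, 0, ....
data OddBelow : List ℕ → Set where
  zero : ∀ {vs} → OddBelow (0 ∷ vs)
  one  : ∀ {vs} → Below vs → OddBelow (1 ∷ vs)

Low⇒Below : ∀ {us} vs → Low us → Below (us ++ vs)
Low⇒Below vs (low x<2) = low x<2
Low⇒Below vs (tie us)  = tie (Low⇒Below vs us)

Plain⇒Below : ∀ {us} → Plain us → Below us
Plain⇒Below []       = []
Plain⇒Below (tie us) = tie (Plain⇒Below us)

Plain-++ : ∀ {us vs} → Plain us → Below vs → Below (us ++ vs)
Plain-++ []       vs = vs
Plain-++ (tie us) vs = tie (Plain-++ us vs)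

OddBelow⇒Below : ∀ {vs} → OddBelow vs → Below vs
OddBelow⇒Below zero    = low (s≤s z≤n)
OddBelow⇒Below (one _) = low (s≤s (s≤s z≤n))

-- A connected visiting order starting at a zero entry of w is an interleaving
-- of the entries to its left, read leftwards, with those to its right.
record Good (P : List ℕ → Set) (w : List ℕ) : Set where
  constructor good
  field
    {left right route} : List ℕ
    split : left ʳ++ 0 ∷ right ≡ w
    visit : Interleaving left right route
    holds : P route

Good-map : ∀ {P Q : List ℕ → Set} {w} → (∀ {vs} → P vs → Q vs) → Good P w → Good Q w
Good-map f (good s v p) = good s v (f p)

leftFirst rightFirst : ∀ l r → Interleaving {A = ℕ} l r _
leftFirst  l r = ++-linear (setoid ℕ) l r
rightFirst l r = swap (++-linear (setoid ℕ) r l)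

-- Blocks r: r has the form Z 2 Z 2 … 2 Z where each Z is 0, 01 or 10.
mutual
  data Blocks : List ℕ → Set where
    z  : ∀ {t} → Tail t → Blocks (0 ∷ t)
    zo : ∀ {t} → Tail t → Blocks (0 ∷ 1 ∷ t)
    oz : ∀ {t} → Tail t → Blocks (1 ∷ 0 ∷ t)

  data Tail : List ℕ → Set where
    []  : Tail []
    sep : ∀ {r} → Blocks r → Tail (2 ∷ r)

mutual
  -- A block is one longer than its sum, a separator 2 is one shorter, and there is one block more
  -- than there are separators.
  length-Blocks : ∀ {r} → Blocks r → length r ≡ suc (sum r)
  length-Blocks (z t)  = cong suc (length-Tail t)
  length-Blocks (zo t) = cong (2 +_) (length-Tail t)
  length-Blocks (oz t) = cong (2 +_) (length-Tail t)

  length-Tail : ∀ {t} → Tail t → length t ≡ sum t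
  length-Tail []      = refl
  length-Tail (sep b) = cong suc (length-Blocks b)

-- A tail follows a block, whose length exceeds its sum by one. The strict inequality for tails
-- makes up for this.
BlocksOrHeavy TailOrHeavy : List ℕ → Set
BlocksOrHeavy r = length r ≤ sum r ⊎ Blocks r
TailOrHeavy   t = length t < sum t ⊎ Tail t

length≤ : ∀ {r} → BlocksOrHeavy r → length r ≤ suc (sum r)
length≤ (inj₁ h) = m≤n⇒m≤1+n h
length≤ (inj₂ b) = ≤-reflexive (length-Blocks b)

-- The entry adds 1 to the length and `2 + y` to the sum. Only for `y` equal to 0 does this merely
-- cancel the surplus length of `Blocks`.
separate : ∀ y {r} → BlocksOrHeavy r → TailOrHeavy (2 + y ∷ r)
separate y       (inj₁ h) = inj₁ (s≤s (s≤s (≤-trans h (m≤n+m _ y))))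
separate zero    (inj₂ b) = inj₂ (sep b)
separate (suc y) (inj₂ b) =
  inj₁ (s≤s (s≤s (≤-trans (≤-reflexive (length-Blocks b)) (s≤s (m≤n+m _ y)))))

0<2 : 0 < 2
0<2 = s≤s z≤n

1<2 : 1 < 2
1<2 = s≤s (s≤s z≤n)

-- Unless two adjacent entries 0 0, or three adjacent entries 0 1 x, 1 0 x,
-- x 0 1 or x 1 0 with x < 2, give a good path at once, every zero belongs to a
-- block Z all of whose neighbours are ≥ 2.
mutual
  scan : ∀ l r → Good OddBelow (l ʳ++ r) ⊎ BlocksOrHeavy r
  scan l [] = inj₂ (inj₁ z≤n)
  scan l (0 ∷ []) = inj₂ (inj₂ (z []))
  scan l (0 ∷ 0 ∷ r) = inj₁ (good refl (rightFirst l (0 ∷ r)) zero)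
  scan l (0 ∷ 1 ∷ []) = inj₂ (inj₂ (zo []))
  scan l (0 ∷ 1 ∷ 0 ∷ r) = inj₁ (good refl (rightFirst l (1 ∷ 0 ∷ r)) (one (low 0<2)))
  scan l (0 ∷ 1 ∷ 1 ∷ r) = inj₁ (good refl (rightFirst l (1 ∷ 1 ∷ r)) (one (low 1<2)))
  scan l (0 ∷ 1 ∷ suc (suc y) ∷ r) =
    Sum.map₂ (Sum.map s≤s zo ∘ separate y) (scan (2 + y ∷ 1 ∷ 0 ∷ l) r)
  scan l (0 ∷ suc (suc y) ∷ r) =
    Sum.map₂ (Sum.map (λ h → h) z ∘ separate y) (scan (2 + y ∷ 0 ∷ l) r)
  scan l (1 ∷ []) = inj₂ (inj₁ (s≤s z≤n))
  scan l (1 ∷ 0 ∷ []) = inj₂ (inj₂ (oz []))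
  scan l (1 ∷ 0 ∷ 0 ∷ r) = inj₁ (good refl (rightFirst (1 ∷ l) (0 ∷ r)) zero)
  scan l (1 ∷ 0 ∷ 1 ∷ r) = inj₁ (good refl (consˡ (rightFirst l (1 ∷ r))) (one (low 1<2)))
  scan l (1 ∷ 0 ∷ suc (suc y) ∷ r) =
    Sum.map₂ (Sum.map s≤s oz ∘ separate y) (scan (2 + y ∷ 0 ∷ 1 ∷ l) r)
  scan l (1 ∷ 1 ∷ r) = Sum.map₂ (inj₁ ∘ s≤s ∘ s≤s) (scanOnes l r)
  scan l (1 ∷ suc (suc y) ∷ r) =
    Sum.map₂ (λ b → inj₁ (s≤s (s≤s (≤-trans (length≤ b) (s≤s (m≤n+m _ y))))))
      (scan (2 + y ∷ 1 ∷ l) r)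
  scan l (suc (suc y) ∷ r) =
    Sum.map₂ (λ b → inj₁ (s≤s (≤-trans (length≤ b) (s≤s (m≤n+m _ y))))) (scan (2 + y ∷ l) r)

  -- A zero right after two ones starts 0 1 1 towards the left. Otherwise the run of ones stops at
  -- the end of the string or at an entry of at least 2, which absorbs the surplus allowed by
  -- `length≤`.
  scanOnes : ∀ l r → Good OddBelow ((1 ∷ 1 ∷ l) ʳ++ r) ⊎ length r ≤ sum r
  scanOnes l [] = inj₂ z≤n
  scanOnes l (0 ∷ r) = inj₁ (good refl (leftFirst (1 ∷ 1 ∷ l) r) (one (low 1<2)))
  scanOnes l (1 ∷ r) = Sum.map₂ s≤s (scanOnes (1 ∷ l) r)
  scanOnes l (suc (suc y) ∷ r) =
    Sum.map₂ (λ b → s≤s (≤-trans (length≤ b) (s≤s (m≤n+m _ y)))) (scan (2 + y ∷ 1 ∷ 1 ∷ l) r)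

blocks : ∀ w → length w ≡ suc (sum w) → Good OddBelow w ⊎ Blocks w
blocks w eq with scan [] w
... | inj₁ g        = inj₁ g
... | inj₂ (inj₁ h) = contradiction h (<⇒≱ (≤-reflexive (sym eq)))
... | inj₂ (inj₂ b) = inj₂ b

-- For even `k`, α rises by 2 right after its 0, so the zero of any pair wins by taking its 1.
-- Without a pair, the path from the last zero leftwards ties with α throughout.
evenPath : ∀ {l r} → Plain l → Blocks r → Good Below (l ʳ++ r)
evenPath {l} p (z [])      = good refl (leftFirst l []) (Plain-++ p [])
evenPath     p (z (sep b)) = evenPath (tie p) b
evenPath {l} p (zo t)      = good refl (rightFirst l (1 ∷ _)) (low 1<2)
evenPath {l} p (oz t)      = good refl (leftFirst (1 ∷ l) _) (low 1<2)

-- The context c, read leftwards after a 2, first meets a pair with its 0 in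
-- front; so a path started at the next pair is better off turning left.
afterPair : ∀ {c t} → Low (2 ∷ c) → Tail t → Good OddBelow (c ʳ++ t) ⊎ Plain t
afterPair c []           = inj₂ []
afterPair c (sep (z t))  = Sum.map₂ tie (afterPair (tie c) t)
afterPair {c} p (sep (zo {t} _)) =
  inj₁ (good refl (consʳ (leftFirst (2 ∷ c) t)) (one (Low⇒Below t p)))
afterPair {c} p (sep (oz {t} _)) =
  inj₁ (good refl (consˡ (leftFirst (2 ∷ c) t)) (one (Low⇒Below t p)))

2∣2+ : ∀ {n} → 2 ∣ n → 2 ∣ 2 + n
2∣2+ = ∣m∣n⇒∣m+n ∣-refl

2∣sum-Plain : ∀ {t} → Plain t → 2 ∣ sum t
2∣sum-Plain []      = 2 ∣0
2∣sum-Plain (tie p) = 2∣2+ (2∣sum-Plain p)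

-- Here `t` lies to the right of a pair 01. Running right over `t` is fine if the next pair is 01
-- (`Low`) or absent (`Plain`). Otherwise a third pair gives a good path, or there are exactly two
-- pairs; the `suc` counts the 1 of the first.
rightOfPair : ∀ c {t} → Tail t → (Low t ⊎ Plain t) ⊎ (Good OddBelow (c ʳ++ t) ⊎ 2 ∣ suc (sum t))
rightOfPair c []           = inj₁ (inj₂ [])
rightOfPair c (sep (z t))  = Sum.map (Sum.map tie tie) (Sum.map₂ 2∣2+) (rightOfPair (0 ∷ 2 ∷ c) t)
rightOfPair c (sep (zo t)) = inj₁ (inj₁ (tie (low 1<2)))
rightOfPair c (sep (oz t)) =
  -- Read leftwards the pair 10 has its 0 in front, as `afterPair` requires. If no pair follows, the
  -- separator 2, the 1 of this pair and the `suc` add 4 minus nothing else odd: the total is 4 plus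
  -- an even sum.
  inj₂ (Sum.map₂ (2∣2+ ∘ 2∣2+ ∘ 2∣sum-Plain) (afterPair {0 ∷ 1 ∷ 2 ∷ c} (tie (low 1<2)) t))

-- The path starts at the first pair and runs right, unless it then meets the
-- second pair with its 1 in front; by parity a third pair must then follow.
oddPath : ∀ {l r} → Plain l → Blocks r → Good OddBelow (l ʳ++ r) ⊎ 2 ∣ sum r
oddPath p (z [])      = inj₂ (2 ∣0)
oddPath p (z (sep b)) = Sum.map₂ 2∣2+ (oddPath (tie p) b)
oddPath {l} p (zo {t} b) with rightOfPair (1 ∷ 0 ∷ l) b
... | inj₁ (inj₁ q) = inj₁ (good refl (rightFirst l (1 ∷ t)) (one (Low⇒Below l q)))
... | inj₁ (inj₂ q) = inj₁ (good refl (rightFirst l (1 ∷ t)) (one (Plain-++ q (Plain⇒Below p))))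
... | inj₂ g        = g
oddPath {l} p (oz {t} b) with afterPair {0 ∷ 1 ∷ l} (tie (low 1<2)) b
... | inj₁ g = inj₁ g
... | inj₂ q = inj₁ (good refl (consˡ (rightFirst l t)) (one (Plain-++ q (Plain⇒Below p))))

evenGood : ∀ w → length w ≡ suc (sum w) → Good Below w
evenGood w eq with blocks w eq
... | inj₁ g = Good-map OddBelow⇒Below g
... | inj₂ b = evenPath [] b

oddGood : ∀ m w → length w ≡ suc (sum w) → sum w ≡ 2 * m + 1 → Good OddBelow w
oddGood m w eq odd with blocks w eq
... | inj₁ g = g
... | inj₂ b with oddPath [] b
...   | inj₁ g = g
...   | inj₂ e =
  contradiction (∣1⇒≡1 (∣m+n∣m⇒∣n {m = 2 * m} (subst (2 ∣_) odd e) (m∣m*n m))) λ ()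

-- Reduction to a max-min problem

sums : Permutation′ p → Vec ℕ p → Vec ℕ p
sums π A = Vec.tabulate (prefixSum π A)

≤lex-trans : ∀ {x y z : Vec ℕ n} → x ≤lex y → y ≤lex z → x ≤lex z
≤lex-trans = Vec.≤-trans (IsEquivalence.isPartialEquivalence isEquivalence) <-resp₂-≡ <-trans

≤lex-antisym : ∀ {x y : Vec ℕ n} → x ≤lex y → y ≤lex x → x ≡ y
≤lex-antisym x≤y y≤x = Pointwise-≡⇒≡ (Vec.≤-antisym sym <-irrefl <-asym x≤y y≤x)

pointwise⇒≤lex : ∀ {x y : Vec ℕ n} → (∀ i → lookup x i ≤ lookup y i) → x ≤lex y
pointwise⇒≤lex {x = []}    {[]}    h = base tt
pointwise⇒≤lex {x = a ∷ x} {b ∷ y} h with m≤n⇒m<n∨m≡n (h zero)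
... | inj₁ a<b = this a<b refl
... | inj₂ a≡b = next a≡b (pointwise⇒≤lex (h ∘ suc))

toList-≤lex : ∀ {x y : Vec ℕ n} → List.Lex-≤ _≡_ _<_ (toList x) (toList y) → x ≤lex y
toList-≤lex {x = []}    {[]}    (List.base _)   = base tt
toList-≤lex {x = _ ∷ _} {_ ∷ _} (List.this a<b) = this a<b refl
toList-≤lex {x = _ ∷ _} {_ ∷ _} (List.next e l) = next e (toList-≤lex l)

sum-tabulate : (f : Fin n → ℕ) → sum (tabulate f) ≡ ∑ f
sum-tabulate {zero}  f = refl
sum-tabulate {suc n} f = cong (f zero +_) (sum-tabulate (f ∘ suc))

weight≡∑ : (A : Vec ℕ n) → weight A ≡ ∑ (lookup A)
weight≡∑ []      = refl
weight≡∑ (x ∷ A) = cong (x +_) (weight≡∑ A)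

sum-take≤ : ∀ i xs → sum (take i xs) ≤ sum xs
sum-take≤ zero    xs       = z≤n
sum-take≤ (suc i) []       = z≤n
sum-take≤ (suc i) (x ∷ xs) = +-monoʳ-≤ x (sum-take≤ i xs)

-- Makes the prefix sums of a string of weight `k` an admissible `U`-string.
prefixSum≤weight : ∀ (π : Permutation′ p) A i → prefixSum π A i ≤ weight A
prefixSum≤weight π A i = begin
  prefixSum π A i                        ≡⟨ prefixSum≡ π A i ⟩
  sum (take (suc (toℕ i)) (visits π A))  ≤⟨ sum-take≤ (suc (toℕ i)) (visits π A) ⟩
  sum (visits π A)                       ≡⟨ sum-tabulate (λ j → lookup A (π ⟨$⟩ʳ j)) ⟩
  ∑ (λ j → lookup A (π ⟨$⟩ʳ j))          ≡⟨ sum-permute (lookup A) π ⟨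
  ∑ (lookup A)                           ≡⟨ weight≡∑ A ⟨
  weight A                               ∎
  where open ≤-Reasoning

All-tabulate : ∀ {P : ℕ → Set} {f : Fin n → ℕ} → (∀ i → P (f i)) → VecAll.All P (Vec.tabulate f)
All-tabulate {zero}  h = []
All-tabulate {suc n} h = h zero ∷ All-tabulate (h ∘ suc)

All-zeros : ∀ n → VecAll.All (_≤ k) (replicate n 0)
All-zeros zero    = []
All-zeros (suc n) = z≤n ∷ All-zeros n

at-zeros : ∀ n i → at (toList (replicate n 0)) i ≡ 0
at-zeros zero    i       = refl
at-zeros (suc n) zero    = refl
at-zeros (suc n) (suc i) = at-zeros n i

-- A scheme is a finite list, so the strings of weight `k` are enumerated inside the box of vectors
-- with entries at most `b`.
vectors : (b p : ℕ) → List (Vec ℕ p)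
vectors b zero    = [ [] ]
vectors b (suc p) = cartesianProductWith _∷_ (upTo (suc b)) (vectors b p)

∈-vectors : ∀ b (A : Vec ℕ p) → weight A ≤ b → A ∈ vectors b p
∈-vectors b []      h = here refl
∈-vectors b (x ∷ A) h = ∈-cartesianProductWith⁺ _∷_
  (∈-upTo⁺ (s≤s (≤-trans (m≤m+n x (weight A)) h))) (∈-vectors b A (≤-trans (m≤n+m (weight A) x) h))

Covers⇒≤lex : ∀ (S : Search p) A → Covers S A → sums (π S) A ≤lex U S
Covers⇒≤lex S A c = pointwise⇒≤lex λ i →
  subst (_≤ lookup (U S) i) (sym (Vec.lookup∘tabulate (prefixSum (π S) A) i)) (proj₂ (c i))

-- `A₀` is a hardest string. By `upper`, one search per string gives a scheme with all `U` at most
-- α. By `lower`, any search covering `A₀` has `U` at least α: this forces equality for the search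
-- chosen for `A₀`, and bounds every other scheme.
isAlpha : ∀ {α : Vec ℕ p} A₀ → weight A₀ ≡ k →
  (∀ A → weight A ≡ k → ∃ λ π → Connected π × sums π A ≤lex α) →
  (∀ π → Connected π → α ≤lex sums π A₀) →
  IsAlpha k p α
isAlpha {p} {k} {α} A₀ wA₀ upper lower =
  (scheme , (ListAll.map⁺ (ListAll.universal (proj₁ ∘ proj₂ ∘ pick) _) , covered)
          , critical , ListAll.map⁺ (ListAll.universal (proj₁ ∘ proj₂ ∘ proj₂ ∘ pick) _))
  , minimal
  where
  Pick : Vec ℕ p → Set
  Pick A = ∃ λ S → ValidSearch k p S × U S ≤lex α × (weight A ≡ k → Covers S A)

  fromOrder : ∀ A → weight A ≡ k → Pick A
  fromOrder A wA with upper A wA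
  ... | π , conn , s≤α = search π (replicate p 0) (sums π A)
    , (conn , All-zeros p , All-tabulate λ i → subst (prefixSum π A i ≤_) wA (prefixSum≤weight π A i))
    , s≤α
    , λ _ i → subst (_≤ prefixSum π A i) (sym (at-zeros p (suc (toℕ i)))) z≤n
            , ≤-reflexive (sym (Vec.lookup∘tabulate (prefixSum π A) i))

  pick : ∀ A → Pick A
  pick A with weight A ≟ k
  ... | yes wA  = fromOrder A wA
  -- The box also contains strings of other weights; they receive the search of `A₀` as a valid
  -- default.
  ... | no  w≢k with fromOrder A₀ wA₀
  ...   | S , valid , U≤α , _ = S , valid , U≤α , λ wA → contradiction wA w≢k

  scheme : List (Search p)
  scheme = map (proj₁ ∘ pick) (vectors k p)

  covered : ∀ A → weight A ≡ k → Any.Any (λ S → Covers S A) scheme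
  covered A wA = Any.map⁺ (Any.map (λ { refl → proj₂ (proj₂ (proj₂ (pick A))) wA })
    (∈-vectors k A (≤-reflexive wA)))

  α≤U : ∀ S → ValidSearch k p S → Covers S A₀ → α ≤lex U S
  α≤U S (conn , _) c = ≤lex-trans (lower (π S) conn) (Covers⇒≤lex S A₀ c)

  critical : Any.Any (λ S → U S ≡ α) scheme
  critical = Any.map⁺ (Any.map (λ { refl → ≤lex-antisym (proj₁ (proj₂ (proj₂ (pick A₀))))
      (α≤U (proj₁ (pick A₀)) (proj₁ (proj₂ (pick A₀))) (proj₂ (proj₂ (proj₂ (pick A₀))) wA₀)) })
    (∈-vectors k A₀ (≤-reflexive wA₀)))

  minimal : ∀ 𝒮 c → IsScheme k p 𝒮 → IsCritical 𝒮 c → α ≤lex c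
  minimal 𝒮 c (valid , cover) (_ , U≤c) with ListAll.lookupAny (ListAll.zip (valid , U≤c)) (cover A₀ wA₀)
  ... | (v , U≤) , cov = ≤lex-trans (α≤U (Any.lookup (cover A₀ wA₀)) v cov) U≤

toList∘tabulate : (f : Fin n → B) → toList (Vec.tabulate f) ≡ tabulate f
toList∘tabulate {zero}  f = refl
toList∘tabulate {suc n} f = cong (f zero ∷_) (toList∘tabulate (f ∘ suc))

partialSums : ℕ → List ℕ → List ℕ
partialSums s []       = []
partialSums s (x ∷ xs) = s + x ∷ partialSums (s + x) xs

tabulate-sum-take : ∀ s (f : Fin n → ℕ) →
  tabulate {n = n} (λ i → s + sum (take (suc (toℕ i)) (tabulate f))) ≡ partialSums s (tabulate f)
tabulate-sum-take {zero}  s f = refl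
tabulate-sum-take {suc n} s f = cong₂ _∷_ (cong (s +_) (+-identityʳ (f zero)))
  (trans (tabulate-cong λ i → sym (+-assoc s (f zero) _)) (tabulate-sum-take (s + f zero) (f ∘ suc)))

toList-sums : ∀ (π : Permutation′ p) A → toList (sums π A) ≡ partialSums 0 (visits π A)
toList-sums π A = trans (toList∘tabulate (prefixSum π A))
  (trans (tabulate-cong (prefixSum≡ π A)) (tabulate-sum-take 0 (λ j → lookup A (π ⟨$⟩ʳ j))))

-- Prefix sums along a connected order as sums over windows.

windowSum : (ℕ → ℕ) → ℕ → ℕ → ℕ
windowSum a l zero    = 0
windowSum a l (suc n) = a l + windowSum a (suc l) n

windowSum-suc : ∀ a l n → windowSum a l (suc n) ≡ windowSum a l n + a (l + n)
windowSum-suc a l zero    = trans (+-identityʳ (a l)) (cong a (sym (+-identityʳ l)))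
windowSum-suc a l (suc n) = trans (cong (a l +_) (windowSum-suc a (suc l) n))
  (trans (sym (+-assoc (a l) (windowSum a (suc l) n) _))
    (cong (λ i → a l + windowSum a (suc l) n + a i) (sym (+-suc l n))))

weight-tabulate : ∀ a l (f : Fin n → ℕ) → (∀ i → f i ≡ a (l + toℕ i)) →
  weight (Vec.tabulate f) ≡ windowSum a l n
weight-tabulate {zero}  a l f h = refl
weight-tabulate {suc n} a l f h = cong₂ _+_ (trans (h zero) (cong a (+-identityʳ l)))
  (weight-tabulate a (suc l) (f ∘ suc) (λ i → trans (h (suc i)) (cong a (+-suc l (toℕ i)))))

-- Stands for `xs` filling an interval of `m + 1` positions. Only its extremes and its sum under one
-- fixed `a` are recorded, which suffices for the induction.
record IsWindow (a : ℕ → ℕ) (xs : List ℕ) (m : ℕ) : Set where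
  constructor isWindow
  field
    nonempty : 0 < length xs
    max≡     : maxL xs ≡ minL xs + m
    sum≡     : sum (map a xs) ≡ windowSum a (minL xs) (suc m)

sum-map-∷ʳ : ∀ (a : ℕ → ℕ) xs x → sum (map a (xs ∷ʳ x)) ≡ sum (map a xs) + a x
sum-map-∷ʳ a xs x = trans (cong sum (map-++ a xs [ x ]))
  (trans (sum-++ (map a xs) [ a x ]) (cong (sum (map a xs) +_) (+-identityʳ (a x))))

-- A step to the left lowers the minimum and puts a term in front of the window sum; a step to the
-- right keeps the minimum and adds a term at the end.
IsWindow-∷ʳ : ∀ {a xs m x} → IsWindow a xs m → Step x xs → IsWindow a (xs ∷ʳ x) (suc m)
IsWindow-∷ʳ {a} {xs} {m} {x} (isWindow ne mx sm) (inj₁ e) = isWindow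
  (subst (0 <_) (sym (length-++ xs)) (m≤n⇒m≤n+o 1 ne))
  (begin
    maxL (xs ∷ʳ x)        ≡⟨ maxL-∷ʳ xs x ne ⟩
    maxL xs ⊔ x           ≡⟨ m≥n⇒m⊔n≡m (≤-trans x≤min (≤-trans (m≤m+n _ m) (≤-reflexive (sym mx)))) ⟩
    maxL xs               ≡⟨ mx ⟩
    minL xs + m           ≡⟨ cong (_+ m) min≡ ⟩
    suc x + m             ≡⟨ +-suc x m ⟨
    x + suc m             ≡⟨ cong (_+ suc m) min′ ⟨
    minL (xs ∷ʳ x) + suc m ∎)
  (begin
    sum (map a (xs ∷ʳ x))                 ≡⟨ sum-map-∷ʳ a xs x ⟩
    sum (map a xs) + a x                  ≡⟨ +-comm (sum (map a xs)) (a x) ⟩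
    a x + sum (map a xs)                  ≡⟨ cong (a x +_) sm ⟩
    a x + windowSum a (minL xs) (suc m)   ≡⟨ cong (λ l → a x + windowSum a l (suc m)) min≡ ⟩
    windowSum a x (suc (suc m))           ≡⟨ cong (λ l → windowSum a l (suc (suc m))) min′ ⟨
    windowSum a (minL (xs ∷ʳ x)) (suc (suc m)) ∎)
  where
  open ≡-Reasoning
  min≡ : minL xs ≡ suc x
  min≡ = trans (sym e) (+-comm x 1)
  x≤min : x ≤ minL xs
  x≤min = ≤-trans (n≤1+n x) (≤-reflexive (sym min≡))
  min′ : minL (xs ∷ʳ x) ≡ x
  min′ = trans (minL-∷ʳ xs x ne) (m≥n⇒m⊓n≡n x≤min)
IsWindow-∷ʳ {a} {xs} {m} {x} (isWindow ne mx sm) (inj₂ e) = isWindow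
  (subst (0 <_) (sym (length-++ xs)) (m≤n⇒m≤n+o 1 ne))
  (begin
    maxL (xs ∷ʳ x)        ≡⟨ maxL-∷ʳ xs x ne ⟩
    maxL xs ⊔ x           ≡⟨ m≤n⇒m⊔n≡n (≤-trans (m≤m+n _ 1) (≤-reflexive (sym e))) ⟩
    x                     ≡⟨ x≡ ⟩
    minL xs + suc m       ≡⟨ cong (_+ suc m) min′ ⟨
    minL (xs ∷ʳ x) + suc m ∎)
  (begin
    sum (map a (xs ∷ʳ x))                                    ≡⟨ sum-map-∷ʳ a xs x ⟩
    sum (map a xs) + a x                                     ≡⟨ cong₂ _+_ sm (cong a x≡) ⟩
    windowSum a (minL xs) (suc m) + a (minL xs + suc m)      ≡⟨ windowSum-suc a (minL xs) (suc m) ⟨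
    windowSum a (minL xs) (suc (suc m))                      ≡⟨ cong (λ l → windowSum a l (suc (suc m))) min′ ⟨
    windowSum a (minL (xs ∷ʳ x)) (suc (suc m))               ∎)
  where
  open ≡-Reasoning
  x≡ : x ≡ minL xs + suc m
  x≡ = trans e (trans (cong (_+ 1) mx) (trans (+-comm _ 1) (sym (+-suc (minL xs) m))))
  min′ : minL (xs ∷ʳ x) ≡ minL xs
  min′ = trans (minL-∷ʳ xs x ne) (m≤n⇒m⊓n≡m (subst (minL xs ≤_) (sym x≡) (m≤m+n _ (suc m))))

lower : Permutation′ p → Fin p → ℕ
lower π i = minL (take (suc (toℕ i)) (order π))

module _ {π : Permutation′ (suc n)} (conn : Connected π) where
  take-suc-order : ∀ i → take (suc (toℕ (suc i))) (order π) ≡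
    take (suc (toℕ (inject₁ i))) (order π) ∷ʳ toℕ (π ⟨$⟩ʳ suc i)
  take-suc-order i = trans (take-suc-tabulate (λ j → toℕ (π ⟨$⟩ʳ j)) (suc i))
    (cong (λ m → take (suc m) (order π) ∷ʳ toℕ (π ⟨$⟩ʳ suc i)) (sym (toℕ-inject₁ i)))

  step : ∀ i → Step (toℕ (π ⟨$⟩ʳ suc i)) (take (suc (toℕ (inject₁ i))) (order π))
  step i = subst (Step _) (trans (πPrefix≡take π (suc (toℕ i)))
    (cong (λ m → take (suc m) (order π)) (sym (toℕ-inject₁ i)))) (conn (suc i) (s≤s z≤n))

  window : ∀ a i → IsWindow a (take (suc (toℕ i)) (order π)) (toℕ i)
  window a = <-weakInduction _ (isWindow (s≤s z≤n) (sym (+-identityʳ _)) refl) λ i w →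
    subst₂ (IsWindow a) (sym (take-suc-order i)) (cong suc (toℕ-inject₁ i)) (IsWindow-∷ʳ w (step i))

  -- The order now enters only through the left end of the window, so lower bounds reduce to
  -- comparing windows of equal length.
  prefixSum≡windowSum : ∀ a i → prefixSum π (Vec.tabulate (a ∘ toℕ)) i ≡ windowSum a (lower π i) (suc (toℕ i))
  prefixSum≡windowSum a i = begin
    prefixSum π A i                               ≡⟨ prefixSum≡ π A i ⟩
    sum (take (suc (toℕ i)) (visits π A))         ≡⟨ cong (sum ∘ take (suc (toℕ i))) visits≡ ⟩
    sum (take (suc (toℕ i)) (map a (order π)))    ≡⟨ cong sum (take-map (suc (toℕ i)) (order π)) ⟩
    sum (map a (take (suc (toℕ i)) (order π)))    ≡⟨ IsWindow.sum≡ (window a i) ⟩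
    windowSum a (lower π i) (suc (toℕ i))         ∎
    where
    open ≡-Reasoning
    A = Vec.tabulate (a ∘ toℕ)
    visits≡ : visits π A ≡ map a (order π)
    visits≡ = trans (tabulate-cong λ j → Vec.lookup∘tabulate (a ∘ toℕ) (π ⟨$⟩ʳ j))
      (sym (map-tabulate (λ j → toℕ (π ⟨$⟩ʳ j)) a))

  lower≡0 : toℕ (π ⟨$⟩ʳ zero) ≡ 0 → ∀ i → lower π i ≡ 0
  lower≡0 π0≡0 = <-weakInduction _ π0≡0 λ i l≡0 → trans (cong minL (take-suc-order i))
    (trans (minL-∷ʳ (take (suc (toℕ (inject₁ i))) (order π)) _ (s≤s z≤n)) (cong (_⊓ toℕ (π ⟨$⟩ʳ suc i)) l≡0))

-- The extremal strings 0 2 0 2 0 … and 0 1 2 0 2 0 …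

-- Unlike `2 * m`, this exposes two entries definitionally at each `suc`.
double : ℕ → ℕ
double zero    = zero
double (suc m) = suc (suc (double m))

double≡2* : ∀ m → double m ≡ 2 * m
double≡2* zero    = refl
double≡2* (suc m) = trans (cong (2 +_) (double≡2* m)) (sym (*-suc 2 m))

-- The pairs of α above level `s`, where `s` starts at 0 for even `k` and at 1 for odd `k`.
steps : ℕ → ℕ → List ℕ
steps s zero    = []
steps s (suc m) = 2 + s ∷ 2 + s ∷ steps (2 + s) m

-- `upTo` unfolds to `applyUpTo`, whose recursion shifts its function; the general `g` and the level
-- `s` follow that shift.
concatMap-pairs : ∀ c (g : ℕ → ℕ) s m → (∀ j → 2 * g j + c ≡ 2 * j + (2 + s)) →
  concatMap (λ j → (2 * j + c) ∷ (2 * j + c) ∷ []) (applyUpTo g m) ≡ steps s m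
concatMap-pairs c g s zero    h = refl
concatMap-pairs c g s (suc m) h = cong₂ _∷_ (h 0) (cong₂ _∷_ (h 0)
  (concatMap-pairs c (g ∘ suc) (2 + s) m λ j → trans (h (suc j))
    (trans (cong (_+ (2 + s)) (trans (*-suc 2 j) (+-comm 2 (2 * j)))) (+-assoc (2 * j) 2 (2 + s)))))

evenString≡ : ∀ m → 0 ∷ steps 0 m ≡ evenString m
evenString≡ m = cong (0 ∷_) (sym (concatMap-pairs 2 (λ j → j) 0 m λ _ → refl))

oddString≡ : ∀ m → 0 ∷ 1 ∷ steps 1 m ≡ oddString m
oddString≡ m = cong (λ xs → 0 ∷ 1 ∷ xs) (sym (concatMap-pairs 3 (λ j → j) 1 m λ _ → refl))

evenEntry oddEntry : ℕ → ℕ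
evenEntry 0             = 0
evenEntry 1             = 2
evenEntry (suc (suc j)) = evenEntry j

oddEntry 0             = 0
oddEntry 1             = 1
oddEntry (suc (suc j)) = evenEntry (suc j)

evenSum-+2 : ∀ l n → windowSum evenEntry (2 + l) n ≡ windowSum evenEntry l n
evenSum-+2 l zero    = refl
evenSum-+2 l (suc n) = cong (evenEntry l +_) (evenSum-+2 (suc l) n)

oddSum≡evenSum : ∀ l n → windowSum oddEntry (2 + l) n ≡ windowSum evenEntry (suc l) n
oddSum≡evenSum l zero    = refl
oddSum≡evenSum l (suc n) = cong (evenEntry (suc l) +_) (oddSum≡evenSum (suc l) n)

mutual
  -- Dropping the first entry of a window switches the parity of its start, so this bound and the
  -- reverse one with slack 2 prove each other.
  evenSum-0≤1 : ∀ n → windowSum evenEntry 0 n ≤ windowSum evenEntry 1 n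
  evenSum-0≤1 zero    = z≤n
  evenSum-0≤1 (suc n) = ≤-trans (evenSum-1≤0 n) (≤-reflexive (cong (2 +_) (sym (evenSum-+2 0 n))))

  evenSum-1≤0 : ∀ n → windowSum evenEntry 1 n ≤ 2 + windowSum evenEntry 0 n
  evenSum-1≤0 zero    = z≤n
  evenSum-1≤0 (suc n) = s≤s (s≤s (≤-trans (≤-reflexive (evenSum-+2 0 n)) (evenSum-0≤1 n)))

evenSum-0≤ : ∀ l n → windowSum evenEntry 0 n ≤ windowSum evenEntry l n
evenSum-0≤ zero          n = ≤-refl
evenSum-0≤ (suc zero)    n = evenSum-0≤1 n
evenSum-0≤ (suc (suc l)) n = ≤-trans (evenSum-0≤ l n) (≤-reflexive (sym (evenSum-+2 l n)))

evenSum-double : ∀ m → windowSum evenEntry 1 (double m) ≡ double m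
evenSum-double zero    = refl
evenSum-double (suc m) = cong (2 +_) (trans (evenSum-+2 1 (double m)) (evenSum-double m))

tabulate-steps : ∀ s m →
  tabulate {n = double m} (λ i → s + windowSum evenEntry 1 (suc (toℕ i))) ≡ steps s m
tabulate-steps s zero    = refl
tabulate-steps s (suc m) = cong₂ _∷_ (+-comm s 2) (cong₂ _∷_ (+-comm s 2) (trans
  (tabulate-cong λ i → trans (cong (λ x → s + (2 + x)) (evenSum-+2 1 (suc (toℕ i))))
    (trans (sym (+-assoc s 2 _)) (cong (_+ windowSum evenEntry 1 (suc (toℕ i))) (+-comm s 2))))
  (tabulate-steps (2 + s) m)))

entries prefixSums : (ℕ → ℕ) → ∀ n → Vec ℕ n
entries    a n = Vec.tabulate (a ∘ toℕ)
prefixSums a n = Vec.tabulate (λ i → windowSum a 0 (suc (toℕ i)))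

weight-entries : ∀ a n → weight (entries a n) ≡ windowSum a 0 n
weight-entries a n = weight-tabulate {n} a 0 (a ∘ toℕ) λ _ → refl

toList-evenSums : ∀ m → toList (prefixSums evenEntry (suc (double m))) ≡ 0 ∷ steps 0 m
toList-evenSums m = trans (toList∘tabulate (λ i → windowSum evenEntry 0 (suc (toℕ i))))
  (cong (0 ∷_) (tabulate-steps 0 m))

toList-oddSums : ∀ m → toList (prefixSums oddEntry (suc (suc (double m)))) ≡ 0 ∷ 1 ∷ steps 1 m
toList-oddSums m = trans (toList∘tabulate (λ i → windowSum oddEntry 0 (suc (toℕ i))))
  (cong (λ xs → 0 ∷ 1 ∷ xs)
    (trans (tabulate-cong λ i → cong suc (oddSum≡evenSum 0 (suc (toℕ i)))) (tabulate-steps 1 m)))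

-- The lower bound from the extremal strings.

prefixSums≤sums : ∀ a (π : Permutation′ p) →
  (∀ i → windowSum a 0 (suc (toℕ i)) ≤ prefixSum π (entries a p) i) →
  prefixSums a p ≤lex sums π (entries a p)
prefixSums≤sums {p} a π h = pointwise⇒≤lex λ i → begin
  lookup (prefixSums a p) i            ≡⟨ Vec.lookup∘tabulate (λ i → windowSum a 0 (suc (toℕ i))) i ⟩
  windowSum a 0 (suc (toℕ i))          ≤⟨ h i ⟩
  prefixSum π (entries a p) i          ≡⟨ Vec.lookup∘tabulate (prefixSum π (entries a p)) i ⟨
  lookup (sums π (entries a p)) i      ∎
  where open ≤-Reasoning

-- No window of a given length is lighter than the one at position 0, so the comparison holds even
-- pointwise.
evenLower : ∀ (π : Permutation′ (suc n)) → Connected π →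
  prefixSums evenEntry (suc n) ≤lex sums π (entries evenEntry (suc n))
evenLower π conn = prefixSums≤sums evenEntry π λ i →
  ≤-trans (evenSum-0≤ (lower π i) (suc (toℕ i))) (≤-reflexive (sym (prefixSum≡windowSum {π = π} conn evenEntry i)))

2≤oddPair : ∀ l → 2 ≤ windowSum oddEntry (suc l) 2
2≤oddPair zero          = s≤s (s≤s z≤n)
2≤oddPair (suc zero)    = s≤s (s≤s z≤n)
2≤oddPair (suc (suc l)) = ≤-trans (evenPair l) (≤-reflexive
   (sym (trans (oddSum≡evenSum (suc l) 2) (evenSum-+2 l 2))))
  where
  evenPair : ∀ l → 2 ≤ windowSum evenEntry l 2
  evenPair zero          = s≤s (s≤s z≤n)
  evenPair (suc zero)    = s≤s (s≤s z≤n)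
  evenPair (suc (suc l)) = evenPair l

secondEntry⇒≤lex : ∀ {a b b′} {x y : Vec ℕ n} → 0 < a ⊎ b < b′ → (0 ∷ b ∷ x) ≤lex (a ∷ b′ ∷ y)
secondEntry⇒≤lex {a = suc a} _           = this (s≤s z≤n) refl
secondEntry⇒≤lex {a = zero}  (inj₂ b<b′) = next refl (this b<b′ refl)

-- An order starting at the leftmost entry 0 can only run right; any other 0
-- has no neighbour below 2.
oddLower : ∀ (π : Permutation′ (2 + n)) → Connected π →
  prefixSums oddEntry (2 + n) ≤lex sums π (entries oddEntry (2 + n))
oddLower {n} π conn with toℕ (π ⟨$⟩ʳ zero) in start
... | zero = prefixSums≤sums oddEntry π λ i → ≤-reflexive (sym (trans (prefixSum≡windowSum {π = π} conn oddEntry i)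
  (cong (λ l → windowSum oddEntry l (suc (toℕ i))) (lower≡0 {π = π} conn start i))))
... | suc zero = secondEntry⇒≤lex (inj₁ (≤-reflexive (sym (trans (prefixSum≡windowSum {π = π} conn oddEntry zero)
  (cong (λ l → windowSum oddEntry l 1) start)))))
-- From position `2 + q` two visits cannot reach position 0, so the second prefix sum is at least 2
-- and exceeds the 1 of α.
... | suc (suc q) = secondEntry⇒≤lex (inj₂ (≤-trans (2≤window 0<lower)
  (≤-reflexive (sym (prefixSum≡windowSum {π = π} conn oddEntry (suc zero))))))
  where
  2≤window : ∀ {l} → 0 < l → 2 ≤ windowSum oddEntry l 2
  2≤window {suc l} _ = 2≤oddPair l

  second : ℕ
  second = toℕ (π ⟨$⟩ʳ suc zero)

  0<second : 0 < second
  0<second with conn (suc zero) (s≤s z≤n)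
  ... | inj₁ e = ≤-trans (s≤s z≤n)
        (≤-reflexive (sym (suc-injective (trans (sym (+-comm second 1)) (trans e start)))))
  ... | inj₂ e = ≤-trans (m≤n+m 1 _) (≤-reflexive (sym e))

  0<lower : 0 < lower π (suc zero)
  0<lower = ⊓-glb 0<second (subst (0 <_) (sym start) (s≤s z≤n))

-- The upper bound from good paths, and the two values of α.

Below⇒≤lex : ∀ {vs} s m → Below vs → length vs ≡ double m →
  List.Lex-≤ _≡_ _<_ (partialSums s vs) (steps s m)
Below⇒≤lex s zero    []       len = List.base tt
Below⇒≤lex s (suc m) (low {x} x<2) len =
  List.this (≤-trans (s≤s (≤-reflexive (+-comm s x))) (+-monoˡ-< s x<2))
Below⇒≤lex s (suc m) (tie {vs} b) len rewrite +-comm s 2 | +-identityʳ s =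
  List.next refl (List.next refl (Below⇒≤lex (2 + s) m b (suc-injective (suc-injective len))))

OddBelow⇒≤lex : ∀ {vs} m → OddBelow vs → length vs ≡ suc (double m) →
  List.Lex-≤ _≡_ _<_ (partialSums 0 vs) (1 ∷ steps 1 m)
OddBelow⇒≤lex m zero    len = List.this (s≤s z≤n)
OddBelow⇒≤lex m (one b) len = List.next refl (Below⇒≤lex 1 m b (suc-injective len))

-- The starting zero is the initial one-entry window, which `realise` extends along the route.
upperFromGood : ∀ {P : List ℕ → Set} {α : Vec ℕ (suc n)} (A : Vec ℕ (suc n)) →
  (∀ {vs} → P vs → length vs ≡ n → List.Lex-≤ _≡_ _<_ (0 ∷ partialSums 0 vs) (toList α)) →
  Good P (toList A) → ∃ λ π → Connected π × sums π A ≤lex α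
upperFromGood {n} {α = α} A below (good {route = vs} split visit holds)
  with unrealise A (subst (λ w → Realised w (0 ∷ vs)) split (realise visit (realise-[ 0 ])))
... | π , conn , eq = π , conn , toList-≤lex (subst (λ xs → List.Lex-≤ _≡_ _<_ xs (toList α))
  (sym (trans (toList-sums π A) (cong (partialSums 0) eq)))
  (below holds (suc-injective (trans (sym (cong length eq)) (length-tabulate (λ j → lookup A (π ⟨$⟩ʳ j)))))))

sum-toList : ∀ (A : Vec ℕ n) → sum (toList A) ≡ weight A
sum-toList []      = refl
sum-toList (x ∷ A) = cong (x +_) (sum-toList A)

length≡suc-sum : ∀ (A : Vec ℕ (suc k)) → weight A ≡ k → length (toList A) ≡ suc (sum (toList A))
length≡suc-sum A wA = trans (Vec.length-toList A) (cong suc (sym (trans (sum-toList A) wA)))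

evenAlpha : ∀ m → IsAlpha (double m) (suc (double m)) (prefixSums evenEntry (suc (double m)))
evenAlpha m = isAlpha (entries evenEntry (suc (double m)))
  (trans (weight-entries evenEntry (suc (double m))) (evenSum-double m))
  (λ A wA → upperFromGood A
    (λ b len → subst (List.Lex-≤ _≡_ _<_ _) (sym (toList-evenSums m)) (List.next refl (Below⇒≤lex 0 m b len)))
    (evenGood (toList A) (length≡suc-sum A wA)))
  evenLower

oddAlpha : ∀ m → IsAlpha (suc (double m)) (2 + double m) (prefixSums oddEntry (2 + double m))
oddAlpha m = isAlpha (entries oddEntry (2 + double m))
  (trans (weight-entries oddEntry (2 + double m))
    (cong suc (trans (oddSum≡evenSum 0 (double m)) (evenSum-double m))))
  (λ A wA → upperFromGood A
    (λ b len → subst (List.Lex-≤ _≡_ _<_ _) (sym (toList-oddSums m)) (List.next refl (OddBelow⇒≤lex m b len)))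
    (oddGood m (toList A) (length≡suc-sum A wA)
      (trans (sum-toList A) (trans wA (trans (cong suc (double≡2* m)) (+-comm 1 (2 * m)))))))
  oddLower

theorem1 : (k : ℕ) →
    ((m : ℕ) → k ≡ 2 * m + 1 →
    Σ (Vec ℕ (suc k)) (λ α → toList α ≡ oddString m × IsAlpha k (suc k) α))
    × ((m : ℕ) → k ≡ 2 * m →
    Σ (Vec ℕ (suc k)) (λ α → toList α ≡ evenString m × IsAlpha k (suc k) α))
theorem1 k = odd , even
  where
  odd : ∀ m → k ≡ 2 * m + 1 → Σ (Vec ℕ (suc k)) (λ α → toList α ≡ oddString m × IsAlpha k (suc k) α)
  -- With `k` expressed through `double m`, matching on `refl` makes the lengths of the vectors
  -- agree.
  odd m eq with trans eq (trans (+-comm (2 * m) 1) (cong suc (sym (double≡2* m))))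
  ... | refl = prefixSums oddEntry (2 + double m) , trans (toList-oddSums m) (oddString≡ m) , oddAlpha m

  even : ∀ m → k ≡ 2 * m → Σ (Vec ℕ (suc k)) (λ α → toList α ≡ evenString m × IsAlpha k (suc k) α)
  even m eq with trans eq (sym (double≡2* m))
  ... | refl = prefixSums evenEntry (suc (double m)) , trans (toList-evenSums m) (evenString≡ m) , evenAlpha m
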